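{- Let $3 \leq r \leq s \leq t$ be integers. Then for sufficiently large $n$, \[ \mathrm{ex}_r ( n , \textup{Berge- }K_{s,t} ) = O \big( n^{ r - \frac{r (r - 1) }{2s} } \big), \] where the implied constant depends only on $r,s,t$.
   Context: A hypergraph $H$ is a Berge-$F$ (for a graph $F$) if there is a bijection $f : E(F) \to E(H)$ with $e \subseteq f(e)$ for every $e \in E(F)$. $\mathrm{ex}_r(n,\textup{Berge- }F)$ is the maximum number of edges in an $n$-vertex $r$-uniform hypergraph containing no subhypergraph that is a Berge-$F$. -}

module Defs where

open import Data.Bool.Base using (if_then_else_)
open import Data.Fin.Base using (Fin; zero; suc; _↑ˡ_; _↑ʳ_; splitAt; fromℕ<; remQuot; combine; funToFin; finToFun)
import Data.Bool.Properties as Bool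
import Data.Fin.Properties as Fin
open import Data.Fin.Subset using (Subset; _∈_; _∪_; ⁅_⁆; ∣_∣)
import Data.Fin.Subset.Properties as Sub
open import Data.Nat.Base using (ℕ; zero; suc; _*_; _+_; _^_; _≤_; _<_; z≤n; s≤s)
import Data.Nat.Properties as ℕ
open import Data.Product.Base using (Σ; ∃; _×_; _,_; proj₁; proj₂; uncurry)
open import Data.Sum.Base using (inj₁; inj₂)
open import Data.Vec.Base using (lookup; tabulate)
open import Data.Vec.Properties using (tabulate∘lookup; tabulate-cong; ≡-dec)
open import Function.Base using (_∘_; id; case_of_)
open import Function.Bundles using (_↣_; _⤖_; mk↣; mk⤖; Injection; Bijection; Inverse)
open import Function.Definitions using (Injective)
open import Relation.Binary.PropositionalEquality
  using (_≡_; _≢_; _≗_; refl; sym; trans; cong; cong₂; subst)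
open import Relation.Nullary.Decidable.Core
  using (Dec; yes; no; does; map′; ¬?; _×-dec_; _→-dec_)
open import Relation.Nullary.Negation.Core using (¬_; contradiction)
open import Relation.Unary using (Decidable)

-- Hypergraphs on the vertex set Fin n.  The edge set is Fin size; since
-- edge is injective there are no repeated edges and size is the number
-- of edges.
record Hypergraph (n : ℕ) : Set where
  field
    size           : ℕ
    edge           : Fin size → Subset n
    edge-injective : Injective _≡_ _≡_ edge

open Hypergraph public

Uniform : ∀ {n} → ℕ → Hypergraph n → Set
Uniform r H = ∀ e → ∣ edge H e ∣ ≡ r

-- A finite simple graph on Fin v, as a 2-uniform hypergraph.
record Graph (v : ℕ) : Set where
  field
    hypergraph : Hypergraph v
    uniform    : Uniform 2 hypergraph

-- Subhypergraphs keep the whole vertex set.  For containing a Berge-F this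
-- loses nothing: adding isolated vertices to a Berge-F gives a Berge-F in
-- the sense of IsBerge.
_⊑_ : ∀ {n} → Hypergraph n → Hypergraph n → Set
H′ ⊑ H = ∀ e → ∃ λ e′ → edge H′ e ≡ edge H e′

-- The vertices of F are placed among those of H by an injection φ, i.e.
-- F is taken up to isomorphism; f is then a bijection E(F) → E(H) with
-- φ(e) ⊆ f(e) for every edge e of F.
IsBerge : ∀ {v n} → Graph v → Hypergraph n → Set
IsBerge {v} {n} F H =
  Σ (Fin v ↣ Fin n) λ φ →
  Σ (Fin (size G) ⤖ Fin (size H)) λ f →
  ∀ e x → x ∈ edge G e → Injection.to φ x ∈ edge H (Bijection.to f e)
  where G = Graph.hypergraph F

BergeFree : ∀ {v n} → Graph v → Hypergraph n → Set
BergeFree {n = n} F H = ¬ (Σ (Hypergraph n) λ H′ → H′ ⊑ H × IsBerge F H′)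

Attainable : ∀ {v} → ℕ → ℕ → Graph v → ℕ → Set
Attainable r n F m =
  Σ (Hypergraph n) λ H → size H ≡ m × Uniform r H × BergeFree F H

pair : ∀ {n} → Fin n → Fin n → Subset n
pair a b = ⁅ a ⁆ ∪ ⁅ b ⁆

∣pair∣≡2 : ∀ {n} (a b : Fin n) → a ≢ b → ∣ pair a b ∣ ≡ 2
∣pair∣≡2 zero    zero    a≢b = contradiction refl a≢b
∣pair∣≡2 zero    (suc b) _   =
  cong suc (trans (cong ∣_∣ (Sub.∪-identityˡ ⁅ b ⁆)) (Sub.∣⁅x⁆∣≡1 b))
∣pair∣≡2 (suc a) zero    _   =
  cong suc (trans (cong ∣_∣ (Sub.∪-identityʳ ⁅ a ⁆)) (Sub.∣⁅x⁆∣≡1 a))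
∣pair∣≡2 (suc a) (suc b) a≢b = ∣pair∣≡2 a b (a≢b ∘ cong suc)

↑ˡ≢↑ʳ : ∀ {s t} (a : Fin s) (b : Fin t) → a ↑ˡ t ≢ s ↑ʳ b
↑ˡ≢↑ʳ {s} {t} a b eq =
  case trans (sym (Fin.splitAt-↑ˡ s a t))
             (trans (cong (splitAt s) eq) (Fin.splitAt-↑ʳ s t b))
  of λ ()

-- The parts are the first s and the last t vertices of Fin (s + t);
-- remQuot t : Fin (s * t) → Fin s × Fin t is the standard bijection, so
-- there is exactly one edge for each pair (a , b).
Kedge : ∀ s t → Fin s × Fin t → Subset (s + t)
Kedge s t (a , b) = pair (a ↑ˡ t) (s ↑ʳ b)

Kedge-injective : ∀ s t → Injective _≡_ _≡_ (Kedge s t)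
Kedge-injective s t {a , b} {a′ , b′} eq = cong₂ _,_ a≡a′ b≡b′
  where
  a∈ : (a ↑ˡ t) ∈ Kedge s t (a′ , b′)
  a∈ = subst (_ ∈_) eq (Sub.x∈p∪q⁺ (inj₁ (Sub.x∈⁅x⁆ _)))

  b∈ : (s ↑ʳ b) ∈ Kedge s t (a′ , b′)
  b∈ = subst (_ ∈_) eq (Sub.x∈p∪q⁺ {p = ⁅ a ↑ˡ t ⁆} (inj₂ (Sub.x∈⁅x⁆ _)))

  a≡a′ : a ≡ a′
  a≡a′ with Sub.x∈p∪q⁻ ⁅ a′ ↑ˡ t ⁆ ⁅ s ↑ʳ b′ ⁆ a∈
  ... | inj₁ p = Fin.↑ˡ-injective t a a′ (Sub.x∈⁅y⁆⇒x≡y _ p)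
  ... | inj₂ p = contradiction (Sub.x∈⁅y⁆⇒x≡y _ p) (↑ˡ≢↑ʳ a b′)

  b≡b′ : b ≡ b′
  b≡b′ with Sub.x∈p∪q⁻ ⁅ a′ ↑ˡ t ⁆ ⁅ s ↑ʳ b′ ⁆ b∈
  ... | inj₁ p = contradiction (sym (Sub.x∈⁅y⁆⇒x≡y _ p)) (↑ˡ≢↑ʳ a′ b)
  ... | inj₂ p = Fin.↑ʳ-injective s b b′ (Sub.x∈⁅y⁆⇒x≡y _ p)

remQuot-injective : ∀ s t → Injective _≡_ _≡_ (remQuot {s} t)
remQuot-injective s t {i} {j} eq =
  trans (sym (Fin.combine-remQuot {s} t i))
        (trans (cong (uncurry combine) eq) (Fin.combine-remQuot {s} t j))

K : ∀ s t → Graph (s + t)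
K s t = record
  { hypergraph = record
    { size           = s * t
    ; edge           = Kedge s t ∘ remQuot {s} t
    ; edge-injective = remQuot-injective s t ∘ Kedge-injective s t
    }
  ; uniform = λ e → ∣pair∣≡2 _ _ (↑ˡ≢↑ʳ (proj₁ (remQuot {s} t e)) _)
  }

anyFun? : ∀ {A : Set} →
          (∀ {Q : A → Set} → Decidable Q → Dec (∃ Q)) →
          ∀ {k} {P : (Fin k → A) → Set} →
          (∀ {f g} → f ≗ g → P f → P g) → Decidable P → Dec (∃ P)
anyFun? {A} any? {zero}  resp P? =
  map′ (empty ,_) (λ (f , p) → resp (λ ()) p) (P? empty)
  where
  empty : Fin 0 → A
  empty ()
anyFun? {A} any? {suc k} {P} resp P? =
  map′ (λ (a , f , p) → cons a f , p)
       (λ (f , p) → f zero , f ∘ suc , resp (λ { zero → refl ; (suc _) → refl }) p)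
       (any? λ a → anyFun? any? (λ eq → resp λ { zero → refl ; (suc i) → eq i })
                                (P? ∘ cons a))
  where
  cons : A → (Fin k → A) → Fin (suc k) → A
  cons a f zero    = a
  cons a f (suc i) = f i

injective? : ∀ {A : Set} → (∀ (a b : A) → Dec (a ≡ b)) →
             ∀ {k} (f : Fin k → A) → Dec (Injective _≡_ _≡_ f)
injective? _≟_ f =
  map′ (λ h {i} {j} → h i j) (λ inj i j → inj {i} {j})
       (Fin.all? λ i → Fin.all? λ j → (f i ≟ f j) →-dec (i Fin.≟ j))

injective-resp : ∀ {A : Set} {k} {f g : Fin k → A} → f ≗ g →
                 Injective _≡_ _≡_ f → Injective _≡_ _≡_ g
injective-resp f≗g inj eq = inj (trans (f≗g _) (trans eq (sym (f≗g _))))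

_≟ˢ_ : ∀ {n} (p q : Subset n) → Dec (p ≡ q)
_≟ˢ_ = ≡-dec Bool._≟_

-- H has a subhypergraph that is a Berge-F iff it has a Copy of F: an
-- injection on vertices together with an injection on edges.
Copy : ∀ {v n m} → Graph v → (Fin m → Subset n) → Set
Copy {v} {n} {m} F E =
  Σ (Fin v → Fin n) λ φ → Injective _≡_ _≡_ φ ×
  Σ (Fin (size G) → Fin m) λ f → Injective _≡_ _≡_ f ×
  (∀ e x → x ∈ edge G e → φ x ∈ E (f e))
  where G = Graph.hypergraph F

copy-resp : ∀ {v n m} (F : Graph v) {E E′ : Fin m → Subset n} → E ≗ E′ →
            Copy F E → Copy F E′
copy-resp F E≗E′ (φ , φ-inj , f , f-inj , cov) =
  φ , φ-inj , f , f-inj , λ e x x∈e → subst (φ x ∈_) (E≗E′ (f e)) (cov e x x∈e)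

copy? : ∀ {v n m} (F : Graph v) (E : Fin m → Subset n) → Dec (Copy F E)
copy? F E =
  anyFun? Fin.any?
    (λ {φ} {ψ} φ≗ψ (inj , f , f-inj , cov) →
      injective-resp φ≗ψ inj , f , f-inj ,
      λ e x x∈e → subst (_∈ E (f e)) (φ≗ψ x) (cov e x x∈e))
    λ φ → injective? Fin._≟_ φ ×-dec
  anyFun? Fin.any?
    (λ {f} {g} f≗g (inj , cov) →
      injective-resp f≗g inj ,
      λ e x x∈e → subst (λ i → φ x ∈ E i) (f≗g e) (cov e x x∈e))
    λ f → injective? Fin._≟_ f ×-dec
  Fin.all? λ e → Fin.all? λ x →
    (x Sub.∈? edge (Graph.hypergraph F) e) →-dec (φ x Sub.∈? E (f e))

copy⇒berge : ∀ {v n} (F : Graph v) (H : Hypergraph n) → Copy F (edge H) →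
             Σ (Hypergraph n) λ H′ → H′ ⊑ H × IsBerge F H′
copy⇒berge F H (φ , φ-inj , f , f-inj , cov) =
  record { size = _ ; edge = edge H ∘ f ; edge-injective = f-inj ∘ edge-injective H } ,
  (λ e → f e , refl) ,
  mk↣ φ-inj , mk⤖ (id , λ e → e , id) , cov

berge⇒copy : ∀ {v n} (F : Graph v) (H : Hypergraph n) →
             (Σ (Hypergraph n) λ H′ → H′ ⊑ H × IsBerge F H′) → Copy F (edge H)
berge⇒copy F H (H′ , sub , φ , f , cov) =
  to φ , injective φ , g ∘ Bijection.to f ,
  Bijection.injective f ∘ g-inj ,
  λ e x x∈e → subst (to φ x ∈_) (proj₂ (sub _)) (cov e x x∈e)
  where
  open Injection using (to; injective)

  g : Fin (size H′) → Fin (size H)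
  g e = proj₁ (sub e)

  g-inj : Injective _≡_ _≡_ g
  g-inj eq = edge-injective H′
    (trans (proj₂ (sub _)) (trans (cong (edge H) eq) (sym (proj₂ (sub _)))))

FreeFamily : ∀ {v n m} → ℕ → Graph v → (Fin m → Subset n) → Set
FreeFamily r F E = Injective _≡_ _≡_ E × (∀ e → ∣ E e ∣ ≡ r) × ¬ Copy F E

freeFamily? : ∀ {v n m} r (F : Graph v) (E : Fin m → Subset n) →
              Dec (FreeFamily r F E)
freeFamily? r F E =
  injective? _≟ˢ_ E ×-dec (Fin.all? λ e → ∣ E e ∣ ℕ.≟ r) ×-dec ¬? (copy? F E)

freeFamily-resp : ∀ {v n m} r (F : Graph v) {E E′ : Fin m → Subset n} →
                  E ≗ E′ → FreeFamily r F E → FreeFamily r F E′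
freeFamily-resp r F E≗E′ (inj , unif , free) =
  injective-resp E≗E′ inj ,
  (λ e → trans (cong ∣_∣ (sym (E≗E′ e))) (unif e)) ,
  free ∘ copy-resp F (sym ∘ E≗E′)

attainable? : ∀ {v} r n (F : Graph v) → Decidable (Attainable r n F)
attainable? r n F m =
  map′ to from
       (anyFun? Sub.anySubset? (freeFamily-resp r F) (freeFamily? r F))
  where
  to : Σ (Fin m → Subset n) (FreeFamily r F) → Attainable r n F m
  to (E , inj , unif , free) = H , refl , unif , free ∘ berge⇒copy F H
    where
    H : Hypergraph n
    H = record { size = m ; edge = E ; edge-injective = inj }

  from : Attainable r n F m → Σ (Fin m → Subset n) (FreeFamily r F)
  from (H , refl , unif , free) =
    edge H , edge-injective H , unif , free ∘ copy⇒berge F H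

-- The largest m ≤ b satisfying P, or 0 if there is none.
largest : ∀ {P : ℕ → Set} → Decidable P → ℕ → ℕ
largest P? zero    = 0
largest P? (suc b) = if does (P? (suc b)) then suc b else largest P? b

-- An n-vertex hypergraph has at most 2 ^ n edges, so the search bound is
-- no restriction: see ex-attained and ex-maximal.
ex : ∀ {v} → ℕ → ℕ → Graph v → ℕ
ex r n F = largest (attainable? r n F) (2 ^ n)

largest-attained : ∀ {P : ℕ → Set} (P? : Decidable P) b {m} → P m → m ≤ b →
                   P (largest P? b)
largest-attained P? zero    p z≤n = p
largest-attained P? (suc b) p m≤1+b with P? (suc b)
... | yes q = q
... | no ¬q with ℕ.m≤n⇒m<n∨m≡n m≤1+b
...   | inj₁ (s≤s m≤b) = largest-attained P? b p m≤b
...   | inj₂ refl      = contradiction p ¬q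

largest-maximal : ∀ {P : ℕ → Set} (P? : Decidable P) b {m} → P m → m ≤ b →
                  m ≤ largest P? b
largest-maximal P? zero    p m≤b = m≤b
largest-maximal P? (suc b) p m≤1+b with P? (suc b)
... | yes _ = m≤1+b
... | no ¬q with ℕ.m≤n⇒m<n∨m≡n m≤1+b
...   | inj₁ (s≤s m≤b) = largest-maximal P? b p m≤b
...   | inj₂ refl      = contradiction p ¬q

size≤2^n : ∀ {n} (H : Hypergraph n) → size H ≤ 2 ^ n
size≤2^n {n} H = Fin.injective⇒≤ (edge-injective H ∘ code-injective)
  where
  open Inverse Fin.2↔Bool using (to; from; inverseˡ)

  bits : Subset n → Fin n → Fin 2
  bits p = from ∘ lookup p

  decode : Fin (2 ^ n) → Subset n
  decode c = tabulate (to ∘ finToFun c)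

  code : Subset n → Fin (2 ^ n)
  code = funToFin ∘ bits

  decode-code : ∀ p → decode (code p) ≡ p
  decode-code p =
    trans (tabulate-cong λ i → inverseˡ (Fin.finToFun-funToFin (bits p) i))
          (tabulate∘lookup p)

  code-injective : Injective _≡_ _≡_ code
  code-injective {p} {q} eq =
    trans (sym (decode-code p)) (trans (cong decode eq) (decode-code q))

attainable≤2^n : ∀ {v} r n (F : Graph v) {m} → Attainable r n F m → m ≤ 2 ^ n
attainable≤2^n r n F (H , refl , _) = size≤2^n H

ex-maximal : ∀ {v} r n (F : Graph v) {m} → Attainable r n F m → m ≤ ex r n F
ex-maximal r n F a =
  largest-maximal (attainable? r n F) (2 ^ n) a (attainable≤2^n r n F a)

-- If F has an edge, the empty hypergraph is Berge-F-free, so the maximum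
-- exists and is attained.
ex-attained : ∀ {v} r n (F : Graph v) → 0 < size (Graph.hypergraph F) →
              Attainable r n F (ex r n F)
ex-attained r n F 0<e =
  largest-attained (attainable? r n F) (2 ^ n) empty z≤n
  where
  empty : Attainable r n F 0
  empty = H , refl , (λ ()) , λ berge → noEdge 0<e (berge⇒copy F H berge)
    where
    H : Hypergraph n
    H = record { size = 0 ; edge = λ () ; edge-injective = λ { {()} } }

    noEdge : 0 < size (Graph.hypergraph F) → ¬ Copy F (edge H)
    noEdge pos (_ , _ , f , _) = Fin.¬Fin0 (f (fromℕ< pos))

infix 3 _=O[n^_/_]

-- f(n) = O(n^(p/q)) for sufficiently large n, where q > 0: the inequality
-- f(n) ≤ C · n^(p/q) between nonnegative reals is raised to the power q.
-- Rounding up, a real constant C may be taken to be a natural number.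
_=O[n^_/_] : (ℕ → ℕ) → ℕ → ℕ → Set
f =O[n^ p / q ] = ∃ λ C → ∃ λ N → ∀ n → N ≤ n → f n ^ q ≤ C ^ q * n ^ p

{-# OPTIONS --safe #-}

-- Assign greedily to each hyperedge a 2-subset of it not yet assigned.  The assigned
-- pairs form a K_{s,t}-free graph G, since a K_{s,t} in G is a Berge-K_{s,t}, and every
-- unassigned hyperedge is an r-clique of G.  So it suffices to bound the number of
-- 2-cliques and of r-cliques in a K_{s,t}-free graph (the bound for r increases with
-- r ≤ s).  Following Alon and Shikhelman, this goes by induction on r: (r+1)-cliques at
-- v are r-cliques in the K_{s-1,t}-free neighbourhood of v, and Hölder's inequality sums
-- the resulting powers of the degrees using Σ_v d(v)^s = O(n^s), which is the
-- Kővári–Sós–Turán argument.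
module Submission where

open import Defs
open import Data.Fin.Base using (Fin; zero; suc; _↑ˡ_; _↑ʳ_; splitAt; remQuot; join)
import Data.Fin.Properties as Fin
open import Data.Fin.Subset using (Subset; _∈_; _⊆_; _∪_; ⁅_⁆; ∣_∣; ⊥; inside; outside)
import Data.Fin.Subset.Properties as Sub
open import Data.List.Base using (List; []; _∷_; map; length; filter; take; concatMap; lookup; allFin; _++_)
import Data.List.Membership.DecPropositional as DecMembership
open import Data.List.Membership.Propositional using (lose) renaming (_∈_ to _∈ˡ_)
open import Data.List.Membership.Propositional.Properties
  using (∈-filter⁺; ∈-filter⁻; ∈-map⁺; ∈-map⁻; ∈-++⁺ˡ; ∈-++⁺ʳ; ∈-concatMap⁺; ∈-lookup; ∈-allFin)
open import Data.List.Properties using (length-take; length-map; length-++; length-tabulate; map-cong)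
open import Data.List.Relation.Unary.All as All using (All; []; _∷_)
import Data.List.Relation.Unary.All.Properties as All
open import Data.List.Relation.Unary.AllPairs using ([]; _∷_)
open import Data.List.Relation.Unary.Any as Any using (here; there)
open import Data.List.Relation.Unary.Any.Properties using (lookup-index)
open import Data.List.Relation.Unary.Unique.Propositional using (Unique)
import Data.List.Relation.Unary.Unique.Propositional.Properties as Unique
open import Data.Nat.Base
open import Data.Nat.Combinatorics using (_C_; nCk+nC[k+1]≡[n+1]C[k+1]; nC1≡n)
open import Data.Nat.ListAction using (sum)
open import Data.Nat.Properties
open import Data.Nat.Tactic.RingSolver using (solve-∀)
open import Data.Product.Base using (∃; ∃₂; _×_; _,_; proj₁; proj₂)
open import Data.Sum.Base using (_⊎_; inj₁; inj₂; [_,_]′)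
open import Data.Vec.Base using ([]; _∷_; here; there)
open import Function.Base using (_∘_; case_of_)
open import Function.Definitions using (Injective)
open import Level using (0ℓ)
open import Relation.Binary.Core using (Rel)
open import Relation.Binary.Definitions using (Decidable; Symmetric; Irreflexive)
open import Relation.Binary.PropositionalEquality
open import Relation.Nullary.Decidable using (yes; no; _×-dec_; ¬?; decidable-stable)
open import Relation.Nullary.Negation.Core using (¬_; contradiction)

-- Powers and binomial coefficients.

^-distribʳ-* : ∀ m n k → (m * n) ^ k ≡ m ^ k * n ^ k
^-distribʳ-* m n zero    = refl
^-distribʳ-* m n (suc k) = trans (cong (m * n *_) (^-distribʳ-* m n k)) (eq m n (m ^ k) (n ^ k))
  where
  eq : ∀ a b c d → a * b * (c * d) ≡ a * c * (b * d)
  eq = solve-∀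

0^k≡0 : ∀ k .{{_ : NonZero k}} → 0 ^ k ≡ 0
0^k≡0 (suc k) = refl

^-cancelʳ-≤ : ∀ k .{{_ : NonZero k}} {m n} → m ^ k ≤ n ^ k → m ≤ n
^-cancelʳ-≤ k m^k≤n^k = ≮⇒≥ λ n<m → <⇒≱ (^-monoˡ-< k n<m) m^k≤n^k

^-swap : ∀ m k l → (m ^ k) ^ l ≡ (m ^ l) ^ k
^-swap m k l = trans (^-*-assoc m k l) (trans (cong (m ^_) (*-comm k l)) (sym (^-*-assoc m l k)))

-- Both sides count the (k+1)-subsets of n+1 points with one marked element. The induction splits
-- the left side by Pascal's rule.
C-absorb : ∀ n k → suc k * (suc n C suc k) ≡ suc n * (n C k)
C-absorb zero    zero    = refl
C-absorb zero    (suc k) = *-zeroʳ (2 + k)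
C-absorb (suc n) zero    = trans (+-identityʳ _) (trans (nC1≡n (2 + n)) (sym (*-identityʳ (2 + n))))
C-absorb (suc n) (suc k) = begin-equality
  (2 + k) * ((2 + n) C (2 + k))
    ≡⟨ cong ((2 + k) *_) (nCk+nC[k+1]≡[n+1]C[k+1] (suc n) (suc k)) ⟨
  (2 + k) * (suc n C suc k + suc n C (2 + k))
    ≡⟨ split k (suc n C suc k) _ ⟩
  suc n C suc k + (suc k * (suc n C suc k) + (2 + k) * (suc n C (2 + k)))
    ≡⟨ cong (suc n C suc k +_) (cong₂ _+_ (C-absorb n k) (C-absorb n (suc k))) ⟩
  suc n C suc k + (suc n * (n C k) + suc n * (n C suc k))
    ≡⟨ cong (suc n C suc k +_) (*-distribˡ-+ (suc n) (n C k) (n C suc k)) ⟨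
  suc n C suc k + suc n * (n C k + n C suc k)
    ≡⟨ cong (λ c → suc n C suc k + suc n * c) (nCk+nC[k+1]≡[n+1]C[k+1] n k) ⟩
  (2 + n) * (suc n C suc k) ∎
  where
  open ≤-Reasoning
  split : ∀ k a b → (2 + k) * (a + b) ≡ a + (suc k * a + (2 + k) * b)
  split = solve-∀

-- This is (n/k)^k ≤ C(n,k). `C-absorb` splits off a factor (n+1)/(k+1) from C(n+1,k+1), and the
-- other k factors are compared by (n+1)/(k+1) ≤ n/k, which holds because k ≤ n.
n^k≤k^k*nCk : ∀ {n k} → k ≤ n → n ^ k ≤ k ^ k * (n C k)
n^k≤k^k*nCk {n}     {zero}        _         = ≤-reflexive refl
n^k≤k^k*nCk {suc n} {suc zero}    _         = ≤-reflexive (trans (*-identityʳ (suc n)) (sym (trans (*-identityˡ (suc n C 1)) (nC1≡n (suc n)))))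
n^k≤k^k*nCk {suc n} {suc k@(suc _)} (s≤s k≤n) = begin
  suc n * suc n ^ k                       ≤⟨ *-monoʳ-≤ (suc n) (*-cancelʳ-≤ _ _ (k ^ k) step) ⟩
  suc n * (suc k ^ k * (n C k))           ≡⟨ eq₁ (suc n) (suc k ^ k) (n C k) ⟩
  suc k ^ k * (suc n * (n C k))           ≡⟨ cong (suc k ^ k *_) (C-absorb n k) ⟨
  suc k ^ k * (suc k * (suc n C suc k))   ≡⟨ eq₂ (suc k ^ k) (suc k) (suc n C suc k) ⟩
  suc k ^ suc k * (suc n C suc k)         ∎
  where
  open ≤-Reasoning
  instance _ = m^n≢0 k k

  eq₁ : ∀ a b c → a * (b * c) ≡ b * (a * c)
  eq₁ = solve-∀

  eq₂ : ∀ a b c → a * (b * c) ≡ b * a * c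
  eq₂ = solve-∀

  step : suc n ^ k * k ^ k ≤ suc k ^ k * (n C k) * k ^ k
  step = begin
    suc n ^ k * k ^ k             ≡⟨ ^-distribʳ-* (suc n) k k ⟨
    (suc n * k) ^ k               ≤⟨ ^-monoˡ-≤ k (≤-trans (+-monoˡ-≤ (n * k) k≤n) (≤-reflexive (cong (n +_) (*-comm n k)))) ⟩
    (suc k * n) ^ k               ≡⟨ ^-distribʳ-* (suc k) n k ⟩
    suc k ^ k * n ^ k             ≤⟨ *-monoʳ-≤ (suc k ^ k) (n^k≤k^k*nCk k≤n) ⟩
    suc k ^ k * (k ^ k * (n C k)) ≡⟨ eq₃ (suc k ^ k) (k ^ k) (n C k) ⟩
    suc k ^ k * (n C k) * k ^ k   ∎
    where
    eq₃ : ∀ a b c → a * (b * c) ≡ a * c * b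
    eq₃ = solve-∀

-- The added 1 pays for n < k, where the binomial coefficient vanishes but n ^ k can be positive.
n^k≤k^k*[1+nCk] : ∀ n k → n ^ k ≤ k ^ k * suc (n C k)
n^k≤k^k*[1+nCk] n k with ≤-total k n
... | inj₁ k≤n = ≤-trans (n^k≤k^k*nCk k≤n) (*-monoʳ-≤ (k ^ k) (n≤1+n (n C k)))
... | inj₂ n≤k = ≤-trans (^-monoˡ-≤ k n≤k) (m≤m*n (k ^ k) (suc (n C k)))

-- Sums over lists and Hölder's inequality for natural numbers.

module _ {A : Set} where

  sum-mono : ∀ {f g : A → ℕ} xs → (∀ {x} → x ∈ˡ xs → f x ≤ g x) →
             sum (map f xs) ≤ sum (map g xs)
  sum-mono []       f≤g = z≤n
  sum-mono (x ∷ xs) f≤g = +-mono-≤ (f≤g (here refl)) (sum-mono xs (f≤g ∘ there))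

  sum-distribˡ-* : ∀ c (f : A → ℕ) xs → sum (map (λ x → c * f x) xs) ≡ c * sum (map f xs)
  sum-distribˡ-* c f []       = sym (*-zeroʳ c)
  sum-distribˡ-* c f (x ∷ xs) =
    trans (cong (c * f x +_) (sum-distribˡ-* c f xs)) (sym (*-distribˡ-+ c (f x) _))

  sum-distribʳ-* : ∀ c (f : A → ℕ) xs → sum (map (λ x → f x * c) xs) ≡ sum (map f xs) * c
  sum-distribʳ-* c f []       = refl
  sum-distribʳ-* c f (x ∷ xs) =
    trans (cong (f x * c +_) (sum-distribʳ-* c f xs)) (sym (*-distribʳ-+ c (f x) _))

  sum-+ : ∀ (f g : A → ℕ) xs →
          sum (map (λ x → f x + g x) xs) ≡ sum (map f xs) + sum (map g xs)
  sum-+ f g []       = refl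
  sum-+ f g (x ∷ xs) =
    trans (cong (f x + g x +_) (sum-+ f g xs)) (eq (f x) (g x) _ _)
    where
    eq : ∀ a b c d → a + b + (c + d) ≡ a + c + (b + d)
    eq = solve-∀

  sum-const : ∀ c (xs : List A) → sum (map (λ _ → c) xs) ≡ length xs * c
  sum-const c []       = refl
  sum-const c (x ∷ xs) = cong (c +_) (sum-const c xs)

-- The hypotheses say x ≤ p / w and y ≤ q / w for the real number w = W ^ (1 / k).
root-superadditive : ∀ k .{{_ : NonZero k}} W {x y p q} → x ^ k * W ≤ p ^ k → y ^ k * W ≤ q ^ k →
                    (x + y) ^ k * W ≤ (p + q) ^ k
root-superadditive k W {x} {y} {p} {q} hx hy = case ≤-total (p * y) (q * x) of λ where
    (inj₁ py≤qx) → ordered hx hy py≤qx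
    (inj₂ qx≤py) → subst₂ (λ a b → a ^ k * W ≤ b ^ k) (+-comm y x) (+-comm q p)
                          (ordered hy hx qx≤py)
  where
  open ≤-Reasoning

  ordered : ∀ {x y p q} → x ^ k * W ≤ p ^ k → y ^ k * W ≤ q ^ k → p * y ≤ q * x →
            (x + y) ^ k * W ≤ (p + q) ^ k
  ordered {x} {y} {zero} {q} hx hy _ with m*n≡0⇒m≡0∨n≡0 (x ^ k) (n≤0⇒n≡0 (≤-trans hx (≤-reflexive (0^k≡0 k))))
  ... | inj₂ refl   = ≤-trans (≤-reflexive (*-zeroʳ ((x + y) ^ k))) z≤n
  ... | inj₁ x^k≡0 = subst (λ a → (a + y) ^ k * W ≤ q ^ k) (sym (m^n≡0⇒m≡0 x k x^k≡0)) hy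
  -- By `py≤qx`, the mediant (x + y) / (p + q) is at most x / p, and `hx` bounds x / p. Multiplying
  -- by p ^ k clears the denominator.
  ordered {x} {y} {p@(suc _)} {q} hx hy py≤qx = *-cancelʳ-≤ _ _ (p ^ k) (begin
    (x + y) ^ k * W * p ^ k     ≡⟨ eq₁ ((x + y) ^ k) W (p ^ k) ⟩
    (x + y) ^ k * p ^ k * W     ≡⟨ cong (_* W) (^-distribʳ-* (x + y) p k) ⟨
    ((x + y) * p) ^ k * W       ≤⟨ *-monoˡ-≤ W (^-monoˡ-≤ k (begin
      (x + y) * p                 ≡⟨ eq₂ x y p ⟩
      x * p + p * y               ≤⟨ +-monoʳ-≤ (x * p) py≤qx ⟩
      x * p + q * x               ≡⟨ eq₃ x p q ⟩
      x * (p + q)                 ∎)) ⟩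
    (x * (p + q)) ^ k * W       ≡⟨ cong (_* W) (^-distribʳ-* x (p + q) k) ⟩
    x ^ k * (p + q) ^ k * W     ≡⟨ eq₁ (x ^ k) ((p + q) ^ k) W ⟩
    x ^ k * W * (p + q) ^ k     ≤⟨ *-monoˡ-≤ _ hx ⟩
    p ^ k * (p + q) ^ k         ≡⟨ *-comm (p ^ k) _ ⟩
    (p + q) ^ k * p ^ k         ∎)
    where
    instance _ = m^n≢0 p k

    eq₁ : ∀ a b c → a * b * c ≡ a * c * b
    eq₁ = solve-∀

    eq₂ : ∀ x y p → (x + y) * p ≡ x * p + p * y
    eq₂ = solve-∀

    eq₃ : ∀ x p q → x * p + q * x ≡ x * (p + q)
    eq₃ = solve-∀

module _ {A : Set} where

  -- With the real number w = W ^ (1 / k), this adds up the inequalities w * f x ≤ g x. Stating them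
  -- through k-th powers keeps the possibly irrational w out of the arithmetic.
  root-sum-superadditive : ∀ k .{{_ : NonZero k}} W {f g : A → ℕ} xs →
    (∀ {x} → x ∈ˡ xs → f x ^ k * W ≤ g x ^ k) →
    sum (map f xs) ^ k * W ≤ sum (map g xs) ^ k
  root-sum-superadditive (suc k) W []       h = z≤n
  root-sum-superadditive k       W (x ∷ xs) h =
    root-superadditive k W (h (here refl)) (root-sum-superadditive k W xs (h ∘ there))

  -- Hölder's inequality, up to the factor 2: the weighted AM-GM inequality of its usual
  -- proof is replaced by u ^ a * v ^ b ≤ (u + v) ^ (a + b).
  hölder : ∀ a b .{{_ : NonZero (a + b)}} c {Y} .{{_ : NonZero Y}} {f g : A → ℕ} xs →
           (∀ {x} → x ∈ˡ xs → f x ^ (a + b) ≤ c ^ (a + b) * g x ^ a) →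
           sum (map g xs) ≤ Y →
           sum (map f xs) ^ (a + b) ≤ (2 * c) ^ (a + b) * (Y ^ a * length xs ^ b)
  hölder a b c []            h _ = ≤-trans (≤-reflexive (0^k≡0 (a + b))) z≤n
  -- The factor n ^ a * Y ^ b rescales the two bases to u = g x * n and v = Y. Each of these sums to
  -- at most Y * n over `xs`, which is where the 2 in 2 * c comes from.
  hölder a b c {Y} {f} {g} xs@(_ ∷ _) h Σg≤Y = *-cancelʳ-≤ _ _ (n ^ a * Y ^ b) (begin
    sum (map f xs) ^ M * (n ^ a * Y ^ b)
      ≤⟨ root-sum-superadditive M (n ^ a * Y ^ b) xs pointwise ⟩
    sum (map (λ x → c * (g x * n + Y)) xs) ^ M
      ≤⟨ ^-monoˡ-≤ M total ⟩
    (2 * c * (Y * n)) ^ M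
      ≡⟨ ^-distribʳ-* (2 * c) (Y * n) M ⟩
    (2 * c) ^ M * (Y * n) ^ M
      ≡⟨ cong ((2 * c) ^ M *_) (^-distribʳ-* Y n M) ⟩
    (2 * c) ^ M * (Y ^ M * n ^ M)
      ≡⟨ cong ((2 * c) ^ M *_) (cong₂ _*_ (^-distribˡ-+-* Y a b) (^-distribˡ-+-* n a b)) ⟩
    (2 * c) ^ M * ((Y ^ a * Y ^ b) * (n ^ a * n ^ b))
      ≡⟨ eq₁ ((2 * c) ^ M) (Y ^ a) (Y ^ b) (n ^ a) (n ^ b) ⟩
    (2 * c) ^ M * (Y ^ a * n ^ b) * (n ^ a * Y ^ b) ∎)
    where
    open ≤-Reasoning
    M = a + b
    n = length xs

    instance
      _ = m^n≢0 n a
      _ = m^n≢0 Y b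
      _ = m*n≢0 (n ^ a) (Y ^ b)

    eq₁ : ∀ c u v w z → c * ((u * v) * (w * z)) ≡ c * (u * z) * (w * v)
    eq₁ = solve-∀

    eq₂ : ∀ c u v w → c * u * (v * w) ≡ c * ((u * v) * w)
    eq₂ = solve-∀

    eq₃ : ∀ c Y n → c * (Y * n + n * Y) ≡ 2 * c * (Y * n)
    eq₃ = solve-∀

    pointwise : ∀ {x} → x ∈ˡ xs → f x ^ M * (n ^ a * Y ^ b) ≤ (c * (g x * n + Y)) ^ M
    pointwise {x} x∈xs = begin
      f x ^ M * (n ^ a * Y ^ b)           ≤⟨ *-monoˡ-≤ (n ^ a * Y ^ b) (h x∈xs) ⟩
      c ^ M * g x ^ a * (n ^ a * Y ^ b)   ≡⟨ eq₂ (c ^ M) (g x ^ a) (n ^ a) (Y ^ b) ⟩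
      c ^ M * (g x ^ a * n ^ a * Y ^ b)   ≡⟨ cong (λ z → c ^ M * (z * Y ^ b)) (^-distribʳ-* (g x) n a) ⟨
      c ^ M * ((g x * n) ^ a * Y ^ b)     ≤⟨ *-monoʳ-≤ (c ^ M) (*-mono-≤ (^-monoˡ-≤ a (m≤m+n (g x * n) Y)) (^-monoˡ-≤ b (m≤n+m Y (g x * n)))) ⟩
      c ^ M * ((g x * n + Y) ^ a * (g x * n + Y) ^ b) ≡⟨ cong (c ^ M *_) (^-distribˡ-+-* (g x * n + Y) a b) ⟨
      c ^ M * (g x * n + Y) ^ M           ≡⟨ ^-distribʳ-* c (g x * n + Y) M ⟨
      (c * (g x * n + Y)) ^ M             ∎

    total : sum (map (λ x → c * (g x * n + Y)) xs) ≤ 2 * c * (Y * n)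
    total = begin
      sum (map (λ x → c * (g x * n + Y)) xs)     ≡⟨ sum-distribˡ-* c (λ x → g x * n + Y) xs ⟩
      c * sum (map (λ x → g x * n + Y) xs)       ≡⟨ cong (c *_) (sum-+ (λ x → g x * n) (λ _ → Y) xs) ⟩
      c * (sum (map (λ x → g x * n) xs) + sum (map (λ _ → Y) xs))
        ≡⟨ cong (c *_) (cong₂ _+_ (sum-distribʳ-* n g xs) (sum-const Y xs)) ⟩
      c * (sum (map g xs) * n + n * Y)           ≤⟨ *-monoʳ-≤ c (+-monoˡ-≤ (n * Y) (*-monoˡ-≤ n Σg≤Y)) ⟩
      c * (Y * n + n * Y)                        ≡⟨ eq₃ c Y n ⟩
      2 * c * (Y * n)                            ∎

-- Cliques in graphs without a complete bipartite subgraph.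

-- The constant for (k+1)-cliques when s = k + 1 + j. Passing to a neighbourhood lowers both the
-- clique size and s by one, so j is fixed in the recursion. Each step costs the 2 of `hölder` and
-- the constant of `degree-moment`.
clique-constant : ℕ → ℕ → ℕ → ℕ
clique-constant zero    j t = 1
clique-constant (suc k) j t = let s = 2 + k + j in 2 * clique-constant k j t * (s ^ s * suc t)

-- The sides come from two separate lists because the induction in `kővári-sós-turán` shrinks X and
-- Y independently.
record Biclique {V : Set} (_~_ : Rel V 0ℓ) (s t : ℕ) (X Y : List V) : Set where
  constructor biclique
  field
    {left right}  : List V
    length-left   : length left ≡ s
    length-right  : length right ≡ t
    unique-left   : Unique left
    unique-right  : Unique right
    left⊆         : All (_∈ˡ X) left
    right⊆        : All (_∈ˡ Y) right
    adjacent      : All (λ y → All (y ~_) left) right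

module Counting {V : Set} {_~_ : Rel V 0ℓ} (_~?_ : Decidable _~_) where

  N : V → List V → List V
  N v = filter (v ~?_)

  -- Counts ordered cliques: each vertex is drawn from the common neighbourhood of the earlier ones.
  -- In a simple graph with vertices listed once, every k-clique is counted k! times.
  cliques : ℕ → List V → ℕ
  cliques zero    A = 1
  cliques (suc k) A = sum (map (λ v → cliques k (N v A)) A)

  -- The number of stars with centre y and s leaves in X.
  degreeC : ℕ → List V → V → ℕ
  degreeC s X y = length (N y X) C s

  -- Pascal's rule at each centre y adjacent to x: the leaves either avoid x, or consist of x and s
  -- further leaves in X.
  degreeC-∷ : ∀ s x X Y →
    sum (map (degreeC (suc s) (x ∷ X)) Y) ≡
    sum (map (degreeC (suc s) X) Y) + sum (map (degreeC s X) (filter (_~? x) Y))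
  degreeC-∷ s x X []      = refl
  degreeC-∷ s x X (y ∷ Y) with y ~? x
  ... | no  _ = trans (cong (length (N y X) C suc s +_) (degreeC-∷ s x X Y))
                      (sym (+-assoc (length (N y X) C suc s) _ _))
  ... | yes _ = trans (cong₂ _+_ (trans (sym (nCk+nC[k+1]≡[n+1]C[k+1] (length (N y X)) s)) (+-comm (length (N y X) C s) _))
                                 (degreeC-∷ s x X Y))
                      (eq (length (N y X) C suc s) (length (N y X) C s) _ _)
    where
    eq : ∀ a b c d → a + b + (c + d) ≡ a + c + (b + d)
    eq = solve-∀

  -- A set of s vertices of X has fewer than t common neighbours in Y, so it is the leaf set of
  -- fewer than t stars. The induction organises this count: stars avoiding x have their leaves in
  -- X, and those using x have centres adjacent to x and s - 1 leaves in X. A biclique found in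
  -- either family gives one in x ∷ X.
  kővári-sós-turán : ∀ s t {X Y} → Unique X → Unique Y → ¬ Biclique _~_ s t X Y →
                     sum (map (degreeC s X) Y) ≤ t * length X ^ s
  kővári-sós-turán zero t {X} {Y} uX uY free = begin
    sum (map (λ _ → 1) Y) ≡⟨ sum-const 1 Y ⟩
    length Y * 1          ≤⟨ *-monoˡ-≤ 1 (≮⇒≥ λ t<∣Y∣ → free (large (<⇒≤ t<∣Y∣))) ⟩
    t * 1                 ∎
    where
    open ≤-Reasoning
    large : t ≤ length Y → Biclique _~_ 0 t X Y
    large t≤∣Y∣ = record
      { left         = []
      ; right        = take t Y
      ; length-left  = refl
      ; length-right = trans (length-take t Y) (m≤n⇒m⊓n≡m t≤∣Y∣)
      ; unique-left  = []
      ; unique-right = Unique.take⁺ t uY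
      ; left⊆        = []
      ; right⊆       = All.take⁺ t (All.tabulate λ y∈Y → y∈Y)
      ; adjacent     = All.tabulate λ _ → []
      }
  kővári-sós-turán (suc s) t {[]} {Y} _ _ _ =
    ≤-trans (≤-reflexive (trans (sum-const 0 Y) (*-zeroʳ (length Y)))) z≤n
  kővári-sós-turán (suc s) t {x ∷ X} {Y} (x≢X ∷ uX) uY free = begin
    sum (map (degreeC (suc s) (x ∷ X)) Y)
      ≡⟨ degreeC-∷ s x X Y ⟩
    sum (map (degreeC (suc s) X) Y) + sum (map (degreeC s X) (filter (_~? x) Y))
      ≤⟨ +-mono-≤ (kővári-sós-turán (suc s) t uX uY (free ∘ skip))
                  (kővári-sós-turán s t uX (Unique.filter⁺ (_~? x) uY) (free ∘ extend)) ⟩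
    t * length X ^ suc s + t * length X ^ s
      ≡⟨ eq t (length X) (length X ^ s) ⟩
    t * (length (x ∷ X) * length X ^ s)
      ≤⟨ *-monoʳ-≤ t (*-monoʳ-≤ (length (x ∷ X)) (^-monoˡ-≤ s (n≤1+n (length X)))) ⟩
    t * length (x ∷ X) ^ suc s ∎
    where
    open ≤-Reasoning
    eq : ∀ t n m → t * (n * m) + t * m ≡ t * (suc n * m)
    eq = solve-∀

    skip : Biclique _~_ (suc s) t X Y → Biclique _~_ (suc s) t (x ∷ X) Y
    skip b = record { Biclique b ; left⊆ = All.map there (Biclique.left⊆ b) }

    extend : Biclique _~_ s t X (filter (_~? x) Y) → Biclique _~_ (suc s) t (x ∷ X) Y
    extend b = record
      { Biclique b
      ; left        = x ∷ left
      ; length-left = cong suc length-left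
      ; unique-left = All.map (All.lookup x≢X) left⊆ ∷ unique-left
      ; left⊆       = here refl ∷ All.map there left⊆
      ; right⊆      = All.map (proj₁ ∘ ∈-filter⁻ (_~? x)) right⊆
      ; adjacent    = All.zipWith (λ (y∈ , ys) → proj₂ (∈-filter⁻ (_~? x) {xs = Y} y∈) ∷ ys) (right⊆ , adjacent)
      }
      where open Biclique b

  degree-moment : ∀ s t {A} .{{_ : NonZero s}} → Unique A → ¬ Biclique _~_ s t A A →
                 sum (map (λ v → length (N v A) ^ s) A) ≤ s ^ s * suc t * length A ^ s
  degree-moment s t {A} uA free = begin
    sum (map (λ v → length (N v A) ^ s) A)
      ≤⟨ sum-mono A (λ {v} _ → n^k≤k^k*[1+nCk] (length (N v A)) s) ⟩
    sum (map (λ v → s ^ s * suc (degreeC s A v)) A)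
      ≡⟨ sum-distribˡ-* (s ^ s) (suc ∘ degreeC s A) A ⟩
    s ^ s * sum (map (λ v → 1 + degreeC s A v) A)
      ≡⟨ cong (s ^ s *_) (trans (sum-+ (λ _ → 1) (degreeC s A) A) (cong (_+ sum (map (degreeC s A) A)) (trans (sum-const 1 A) (*-identityʳ (length A))))) ⟩
    s ^ s * (length A + sum (map (degreeC s A) A))
      ≤⟨ *-monoʳ-≤ (s ^ s) (+-mono-≤ (n≤n^s (length A) s) (kővári-sós-turán s t uA uA free)) ⟩
    s ^ s * (length A ^ s + t * length A ^ s)
      ≡⟨ *-assoc (s ^ s) (suc t) (length A ^ s) ⟨
    s ^ s * suc t * length A ^ s ∎
    where
    open ≤-Reasoning
    n≤n^s : ∀ n s .{{_ : NonZero s}} → n ≤ n ^ s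
    n≤n^s zero      s       = z≤n
    n≤n^s n@(suc _) (suc s) = m≤m*n n (n ^ s) {{m^n≢0 n s}}

  module _ (sym~ : Symmetric _~_) (irrefl : Irreflexive _≡_ _~_) where

    -- The vertex v joins the left side: it is adjacent to all of N v A, and irreflexivity makes it
    -- differ from the left vertices already there.
    neighbourhood-free : ∀ {s t A v} → v ∈ˡ A →
      ¬ Biclique _~_ (suc s) t A A → ¬ Biclique _~_ s t (N v A) (N v A)
    neighbourhood-free {A = A} {v} v∈A free b = free (record
      { Biclique b
      ; left        = v ∷ left
      ; length-left = cong suc length-left
      ; unique-left = All.map (λ x∈ v≡x → irrefl v≡x (proj₂ (∈-filter⁻ (v ~?_) {xs = A} x∈))) left⊆ ∷ unique-left
      ; left⊆       = v∈A ∷ All.map (proj₁ ∘ ∈-filter⁻ (v ~?_)) left⊆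
      ; right⊆      = All.map (proj₁ ∘ ∈-filter⁻ (v ~?_)) right⊆
      ; adjacent    = All.zipWith (λ (y∈ , ys) → sym~ (proj₂ (∈-filter⁻ (v ~?_) {xs = A} y∈)) ∷ ys) (right⊆ , adjacent)
      })
      where open Biclique b

    -- With K = suc k and s = K + j, the exponent of length A is 2 K s - K (K - 1).
    cliques-bound : ∀ k j t {A} → Unique A →
      ¬ Biclique _~_ (suc k + j) t A A →
      cliques (suc k) A ^ (2 * (suc k + j)) ≤
      clique-constant k j t ^ (2 * (suc k + j)) * length A ^ (suc k * (suc k + suc (2 * j)))
    cliques-bound zero j t {A} _ _ = ≤-reflexive (begin
      cliques 1 A ^ (2 * suc j)               ≡⟨ cong (_^ (2 * suc j)) (trans (sum-const 1 A) (*-identityʳ (length A))) ⟩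
      length A ^ (2 * suc j)                  ≡⟨ cong (length A ^_) (eq j) ⟩
      length A ^ (1 * (1 + suc (2 * j)))      ≡⟨ *-identityˡ _ ⟨
      1 * length A ^ (1 * (1 + suc (2 * j)))  ≡⟨ cong (_* length A ^ (1 * (1 + suc (2 * j)))) (^-zeroˡ (2 * suc j)) ⟨
      1 ^ (2 * suc j) * length A ^ (1 * (1 + suc (2 * j))) ∎)
      where
      open ≡-Reasoning
      eq : ∀ j → 2 * suc j ≡ 1 * (1 + suc (2 * j))
      eq = solve-∀
    cliques-bound (suc m) j t = bound
      where
      k  = suc m
      s₀ = k + j
      s  = suc s₀
      D  = s ^ s * suc t
      a  = k * (k + suc (2 * j))
      -- This is 2 * s₀ * s - a without subtraction. The total must be 2 * s₀ * s because the
      -- induction hypothesis, with exponent 2 * s₀, is raised to the power s to turn degrees d into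
      -- d ^ s.
      b  = a + 2 * j + 2 * (j * j)
      e  = suc k * (suc k + suc (2 * j))
      M  = a + b

      c  = clique-constant m j t

      eq₁ : ∀ m j → let k = suc m; s₀ = k + j; s = suc s₀; a = k * (k + suc (2 * j)) in
            a + (a + 2 * j + 2 * (j * j)) ≡ 2 * s₀ * s
      eq₁ = solve-∀

      eq₂ : ∀ m j → let k = suc m; s₀ = k + j; s = suc s₀; a = k * (k + suc (2 * j)) in
            2 * s₀ * s ≡ 2 * s * s₀
      eq₂ = solve-∀

      eq₃ : ∀ m j → let k = suc m; s₀ = k + j; s = suc s₀; a = k * (k + suc (2 * j)) in
            s * a + (a + 2 * j + 2 * (j * j)) ≡ suc k * (suc k + suc (2 * j)) * s₀
      eq₃ = solve-∀

      eq₄ : ∀ u v w z → u * (v * w * z) ≡ u * v * (w * z)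
      eq₄ = solve-∀

      open ≤-Reasoning
      instance
        _ = m^n≢0 s s
        _ = m*n≢0 (s ^ s) (suc t)

      bound : ∀ {A} → Unique A → ¬ Biclique _~_ s t A A →
              cliques (suc k) A ^ (2 * s) ≤ (2 * c * D) ^ (2 * s) * length A ^ e
      -- The empty list is separate because `hölder` takes a nonzero bound, here D * n ^ s.
      bound {[]} _ _ = z≤n
      -- `hölder` controls the power 2 * s₀ * s, so the claim is proved for s₀-th powers and the
      -- root is taken.
      bound {A@(_ ∷ _)} uA free = ^-cancelʳ-≤ s₀ (begin
        (cliques (suc k) A ^ (2 * s)) ^ s₀
          ≡⟨ ^-*-assoc (cliques (suc k) A) (2 * s) s₀ ⟩
        cliques (suc k) A ^ (2 * s * s₀)
          ≡⟨ cong (cliques (suc k) A ^_) (trans (eq₁ m j) (eq₂ m j)) ⟨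
        cliques (suc k) A ^ M
          ≤⟨ hölder a b c {f = λ v → cliques k (N v A)} {g = λ v → length (N v A) ^ s} A pointwise (degree-moment s t uA free) ⟩
        (2 * c) ^ M * ((D * n ^ s) ^ a * n ^ b)
          ≡⟨ cong (λ z → (2 * c) ^ M * (z * n ^ b)) (^-distribʳ-* D (n ^ s) a) ⟩
        (2 * c) ^ M * (D ^ a * (n ^ s) ^ a * n ^ b)
          -- Enlarging D ^ a to D ^ M lets D join 2 * c in one constant raised to the power M.
          ≤⟨ *-monoʳ-≤ ((2 * c) ^ M) (*-monoˡ-≤ (n ^ b) (*-monoˡ-≤ ((n ^ s) ^ a) (^-monoʳ-≤ D (m≤m+n a b)))) ⟩
        (2 * c) ^ M * (D ^ M * (n ^ s) ^ a * n ^ b)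
          ≡⟨ eq₄ ((2 * c) ^ M) (D ^ M) ((n ^ s) ^ a) (n ^ b) ⟩
        (2 * c) ^ M * D ^ M * ((n ^ s) ^ a * n ^ b)
          ≡⟨ cong₂ _*_ (^-distribʳ-* (2 * c) D M) (trans (^-distribˡ-+-* n (s * a) b) (cong (_* n ^ b) (sym (^-*-assoc n s a)))) ⟨
        (2 * c * D) ^ M * n ^ (s * a + b)
          ≡⟨ cong₂ (λ p q → (2 * c * D) ^ p * n ^ q) (trans (eq₁ m j) (eq₂ m j)) (eq₃ m j) ⟩
        (2 * c * D) ^ (2 * s * s₀) * n ^ (e * s₀)
          ≡⟨ cong₂ _*_ (^-*-assoc (2 * c * D) (2 * s) s₀) (^-*-assoc n e s₀) ⟨
        ((2 * c * D) ^ (2 * s)) ^ s₀ * (n ^ e) ^ s₀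
          ≡⟨ ^-distribʳ-* ((2 * c * D) ^ (2 * s)) (n ^ e) s₀ ⟨
        ((2 * c * D) ^ (2 * s) * n ^ e) ^ s₀ ∎)
        where
        n = length A

        instance
          _ = m^n≢0 n s
          _ = m*n≢0 D (n ^ s)

        pointwise : ∀ {v} → v ∈ˡ A → cliques k (N v A) ^ M ≤ c ^ M * (length (N v A) ^ s) ^ a
        pointwise {v} v∈A = begin
          x ^ M                       ≡⟨ cong (x ^_) (eq₁ m j) ⟩
          x ^ (2 * s₀ * s)            ≡⟨ ^-*-assoc x (2 * s₀) s ⟨
          (x ^ (2 * s₀)) ^ s          ≤⟨ ^-monoˡ-≤ s (cliques-bound m j t (Unique.filter⁺ (v ~?_) uA) (neighbourhood-free v∈A free)) ⟩
          (c ^ (2 * s₀) * d ^ a) ^ s  ≡⟨ ^-distribʳ-* (c ^ (2 * s₀)) (d ^ a) s ⟩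
          (c ^ (2 * s₀)) ^ s * (d ^ a) ^ s
            ≡⟨ cong₂ _*_ (trans (^-*-assoc c (2 * s₀) s) (cong (c ^_) (sym (eq₁ m j)))) (^-swap d a s) ⟩
          c ^ M * (d ^ s) ^ a         ∎
          where
          x = cliques k (N v A)
          d = length (N v A)

-- Cliques listed as vertex subsets.

injection⇒≤length : ∀ {A : Set} {m} {f : Fin m → A} {xs} → Injective _≡_ _≡_ f →
                    (∀ i → f i ∈ˡ xs) → m ≤ length xs
injection⇒≤length {f = f} {xs} f-inj f∈xs = Fin.injective⇒≤ {f = Any.index ∘ f∈xs} λ {i} {j} eq →
  f-inj (trans (lookup-index (f∈xs i)) (trans (cong (lookup xs) eq) (sym (lookup-index (f∈xs j)))))

length-concatMap : ∀ {A B : Set} (f : A → List B) xs → length (concatMap f xs) ≡ sum (map (length ∘ f) xs)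
length-concatMap f []       = refl
length-concatMap f (x ∷ xs) = trans (length-++ (f x)) (cong (length (f x) +_) (length-concatMap f xs))

remove-element : ∀ {n k} (p : Subset n) → ∣ p ∣ ≡ suc k →
  ∃₂ λ v q → v ∈ p × ∣ q ∣ ≡ k × p ≡ ⁅ v ⁆ ∪ q × (∀ {x} → x ∈ q → x ∈ p × v ≢ x)
remove-element (inside ∷ p) eq =
  zero , outside ∷ p , here , suc-injective eq , cong (inside ∷_) (sym (Sub.∪-identityˡ p)) ,
  λ { (there x∈p) → there x∈p , λ () }
remove-element (outside ∷ p) eq =
  let v , q , v∈p , ∣q∣ , p≡ , q⊆ = remove-element p eq in
  suc v , outside ∷ q , there v∈p , ∣q∣ , cong (outside ∷_) p≡ ,
  λ { (there x∈q) → there (proj₁ (q⊆ x∈q)) , proj₂ (q⊆ x∈q) ∘ Fin.suc-injective }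

∣p∣≡0⇒p≡⊥ : ∀ {n} (p : Subset n) → ∣ p ∣ ≡ 0 → p ≡ ⊥
∣p∣≡0⇒p≡⊥ []            _  = refl
∣p∣≡0⇒p≡⊥ (outside ∷ p) eq = cong (outside ∷_) (∣p∣≡0⇒p≡⊥ p eq)

module CliqueSets {n} {_~_ : Rel (Fin n) 0ℓ} (_~?_ : Decidable _~_) where

  open Counting _~?_ public

  -- The recursion copies that of `cliques`, so the lengths agree. A clique may be listed several
  -- times, which is harmless for an upper bound.
  cliqueSets : ℕ → List (Fin n) → List (Subset n)
  cliqueSets zero    A = ⊥ ∷ []
  cliqueSets (suc k) A = concatMap (λ v → map (⁅ v ⁆ ∪_) (cliqueSets k (N v A))) A

  length-cliqueSets : ∀ k A → length (cliqueSets k A) ≡ cliques k A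
  length-cliqueSets zero    A = refl
  length-cliqueSets (suc k) A =
    trans (length-concatMap (λ v → map (⁅ v ⁆ ∪_) (cliqueSets k (N v A))) A)
          (cong sum (map-cong (λ v → trans (length-map (⁅ v ⁆ ∪_) (cliqueSets k (N v A))) (length-cliqueSets k (N v A))) A))

  -- One ordering of p suffices: the element removed first serves as v, and the clique condition
  -- puts the remaining ones in N v A.
  ∈-cliqueSets : ∀ k A p → ∣ p ∣ ≡ k → (∀ {x} → x ∈ p → x ∈ˡ A) →
                 (∀ {x y} → x ∈ p → y ∈ p → x ≢ y → x ~ y) → p ∈ˡ cliqueSets k A
  ∈-cliqueSets zero    A p ∣p∣ _   _      = here (∣p∣≡0⇒p≡⊥ p ∣p∣)
  ∈-cliqueSets (suc k) A p ∣p∣ p⊆A clique with remove-element p ∣p∣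
  ... | v , q , v∈p , ∣q∣ , refl , q⊆ =
    ∈-concatMap⁺ (λ v → map (⁅ v ⁆ ∪_) (cliqueSets k (N v A))) (lose (p⊆A v∈p) (∈-map⁺ (⁅ v ⁆ ∪_)
      (∈-cliqueSets k (N v A) q ∣q∣
        (λ x∈q → let x∈p , v≢x = q⊆ x∈q in ∈-filter⁺ (v ~?_) (p⊆A x∈p) (clique v∈p x∈p v≢x))
        (λ x∈q y∈q → clique (proj₁ (q⊆ x∈q)) (proj₁ (q⊆ y∈q))))))

-- Two-element sets and the greedy assignment.

pair-comm : ∀ {n} (a b : Fin n) → pair a b ≡ pair b a
pair-comm a b = Sub.∪-comm ⁅ a ⁆ ⁅ b ⁆

∈-pair⁻ : ∀ {n} {x : Fin n} a b → x ∈ pair a b → x ≡ a ⊎ x ≡ b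
∈-pair⁻ a b x∈ with Sub.x∈p∪q⁻ ⁅ a ⁆ ⁅ b ⁆ x∈
... | inj₁ x∈a = inj₁ (Sub.x∈⁅y⁆⇒x≡y a x∈a)
... | inj₂ x∈b = inj₂ (Sub.x∈⁅y⁆⇒x≡y b x∈b)

a∈pair : ∀ {n} (a b : Fin n) → a ∈ pair a b
a∈pair a b = Sub.x∈p∪q⁺ (inj₁ (Sub.x∈⁅x⁆ a))

b∈pair : ∀ {n} (a b : Fin n) → b ∈ pair a b
b∈pair a b = Sub.x∈p∪q⁺ {p = ⁅ a ⁆} (inj₂ (Sub.x∈⁅x⁆ b))

pair⊆ : ∀ {n} {a b : Fin n} {p} → a ∈ p → b ∈ p → pair a b ⊆ p
pair⊆ {a = a} {b} {p} a∈p b∈p x∈ with ∈-pair⁻ a b x∈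
... | inj₁ refl = a∈p
... | inj₂ refl = b∈p

-- The two inequalities exclude the swapped identification. In a biclique they hold because opposite
-- sides are disjoint.
pair-injective : ∀ {n} {a b a′ b′ : Fin n} → a ≢ b′ → b ≢ a′ →
                 pair a b ≡ pair a′ b′ → a ≡ a′ × b ≡ b′
pair-injective {a = a} {b} {a′} {b′} a≢b′ b≢a′ eq
  with ∈-pair⁻ a′ b′ (subst (a ∈_) eq (a∈pair a b)) | ∈-pair⁻ a′ b′ (subst (b ∈_) eq (b∈pair a b))
... | inj₂ a≡b′ | _         = contradiction a≡b′ a≢b′
... | inj₁ _    | inj₁ b≡a′ = contradiction b≡a′ b≢a′
... | inj₁ a≡a′ | inj₂ b≡b′ = a≡a′ , b≡b′

-- A partial injection from the hyperedges es to the 2-sets they contain, maximal in the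
-- sense that no unmatched hyperedge can be added.
record Matching {n m} (E : Fin m → Subset n) (es : List (Fin m)) : Set where
  field
    matched     : List (Fin m × Subset n)
    fst-unique  : Unique (map proj₁ matched)
    snd-unique  : Unique (map proj₂ matched)
    fst∈        : All (λ z → proj₁ z ∈ˡ es) matched
    two-subset  : All (λ z → ∣ proj₂ z ∣ ≡ 2 × proj₂ z ⊆ E (proj₁ z)) matched
    maximal     : ∀ {e} → e ∈ˡ es → e ∈ˡ map proj₁ matched ⊎
                  (∀ p → ∣ p ∣ ≡ 2 → p ⊆ E e → p ∈ˡ map proj₂ matched)

module _ {n m} (E : Fin m → Subset n) where

  open DecMembership (_≟ˢ_ {n}) using (_∈?_)

  greedy : ∀ es → Unique es → Matching E es
  greedy [] _ = record
    { matched = [] ; fst-unique = [] ; snd-unique = [] ; fst∈ = [] ; two-subset = [] ; maximal = λ () }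
  greedy (e ∷ es) (e≢es ∷ u) = case Sub.anySubset? free? of λ where
      (yes (p , ∣p∣ , p⊆ , p∉)) → record
        { matched    = (e , p) ∷ matched
        -- By `fst∈`, everything matched so far lies in the tail, which does not contain e.
        ; fst-unique = All.map⁺ (All.map (All.lookup e≢es) fst∈) ∷ fst-unique
        ; snd-unique = All.tabulate (λ { q∈ refl → p∉ q∈ }) ∷ snd-unique
        ; fst∈       = here refl ∷ All.map there fst∈
        ; two-subset = (∣p∣ , p⊆) ∷ two-subset
        ; maximal    = λ where
            (here refl) → inj₁ (here refl)
            (there e∈)  → case maximal e∈ of λ where
              (inj₁ e∈M) → inj₁ (there e∈M)
              -- A hyperedge whose pairs are all taken remains blocked as the matching grows.
              (inj₂ all) → inj₂ λ q ∣q∣ q⊆ → there (all q ∣q∣ q⊆)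
        }
      (no ∄p) → record
        { matched    = matched
        ; fst-unique = fst-unique
        ; snd-unique = snd-unique
        ; fst∈       = All.map there fst∈
        ; two-subset = two-subset
        ; maximal    = λ where
            (here refl) → inj₂ λ q ∣q∣ q⊆ → decidable-stable (q ∈? map proj₂ matched) λ q∉ → ∄p (q , ∣q∣ , q⊆ , q∉)
            (there e∈)  → maximal e∈
        }
    where
    open Matching (greedy es u)

    free? = λ p → (∣ p ∣ ≟ 2) ×-dec (p Sub.⊆? E e) ×-dec ¬? (p ∈? map proj₂ matched)

-- The graph of assigned pairs.

pair≡ : ∀ {n} {a b : Fin n} {p} → ∣ p ∣ ≡ 2 → a ∈ p → b ∈ p → a ≢ b → pair a b ≡ p
pair≡ {a = a} {b} {p} ∣p∣ a∈p b∈p a≢b = Sub.⊆-antisym (pair⊆ a∈p b∈p) λ {z} z∈p →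
  decidable-stable (z Sub.∈? pair a b) λ z∉ →
    <-irrefl (trans (∣pair∣≡2 a b a≢b) (sym ∣p∣)) (Sub.p⊂q⇒∣p∣<∣q∣ (pair⊆ a∈p b∈p , z , z∈p , z∉))

map-unique⇒injective : ∀ {A B : Set} {f : A → B} {xs} → Unique (map f xs) →
                       ∀ {x y} → x ∈ˡ xs → y ∈ˡ xs → f x ≡ f y → x ≡ y
map-unique⇒injective (_ ∷ _)      (here refl) (here refl) _  = refl
map-unique⇒injective {f = f} (x≢ ∷ _) (here refl) (there y∈) eq = contradiction eq (All.lookup x≢ (∈-map⁺ f y∈))
map-unique⇒injective {f = f} (x≢ ∷ _) (there x∈) (here refl) eq = contradiction (sym eq) (All.lookup x≢ (∈-map⁺ f x∈))
map-unique⇒injective (_ ∷ u)      (there x∈) (there y∈)  eq = map-unique⇒injective u x∈ y∈ eq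

lookup-injective : ∀ {A : Set} {xs : List A} → Unique xs → Injective _≡_ _≡_ (lookup xs)
lookup-injective (_  ∷ _) {zero}  {zero}  _  = refl
lookup-injective (x≢ ∷ _) {zero}  {suc j} eq = contradiction eq (All.lookup x≢ (∈-lookup j))
lookup-injective (x≢ ∷ _) {suc i} {zero}  eq = contradiction (sym eq) (All.lookup x≢ (∈-lookup i))
lookup-injective (_  ∷ u) {suc i} {suc j} eq = cong suc (lookup-injective u eq)

module MatchedGraph {n m} {E : Fin m → Subset n} {es} (M : Matching E es) where

  open Matching M
  open DecMembership (_≟ˢ_ {n}) using (_∈?_)

  _~_ : Rel (Fin n) 0ℓ
  a ~ b = a ≢ b × pair a b ∈ˡ map proj₂ matched

  _~?_ : Decidable _~_
  a ~? b = ¬? (a Fin.≟ b) ×-dec (pair a b ∈? map proj₂ matched)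

  ~-sym : Symmetric _~_
  ~-sym {a} {b} (a≢b , ab∈) = a≢b ∘ sym , subst (_∈ˡ map proj₂ matched) (pair-comm a b) ab∈

  ~-irrefl : Irreflexive _≡_ _~_
  ~-irrefl a≡b (a≢b , _) = a≢b a≡b

  -- Each edge of the biclique is an assigned pair, and the hyperedge it is assigned to contains it.
  -- Distinct edges are distinct pairs, and these have distinct hyperedges because no hyperedge is
  -- matched twice.
  biclique⇒copy : ∀ {s t X Y} → Biclique _~_ s t X Y → Copy (K s t) E
  biclique⇒copy (biclique {left} {right} refl refl uˡ uʳ _ _ adj) =
    φ , φ-injective , proj₁ ∘ host ∘ remQuot t ,
    remQuot-injective s t ∘ host-injective , λ e x → covers (remQuot t e)
    where
    s = length left
    t = length right

    adjacent : ∀ a b → lookup right b ~ lookup left a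
    adjacent a b = All.lookup (All.lookup adj (∈-lookup b)) (∈-lookup a)

    vertex : Fin s ⊎ Fin t → Fin n
    vertex = [ lookup left , lookup right ]′

    -- A left vertex and a right vertex differ because they are adjacent.
    vertex-injective : Injective _≡_ _≡_ vertex
    vertex-injective {inj₁ a} {inj₁ a′} eq = cong inj₁ (lookup-injective uˡ eq)
    vertex-injective {inj₁ a} {inj₂ b}  eq = contradiction (sym eq) (proj₁ (adjacent a b))
    vertex-injective {inj₂ b} {inj₁ a}  eq = contradiction eq (proj₁ (adjacent a b))
    vertex-injective {inj₂ b} {inj₂ b′} eq = cong inj₂ (lookup-injective uʳ eq)

    φ : Fin (s + t) → Fin n
    φ = vertex ∘ splitAt s

    φ-injective : Injective _≡_ _≡_ φ
    φ-injective {i} {j} eq =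
      trans (sym (Fin.join-splitAt s t i))
            (trans (cong (join s t) (vertex-injective {splitAt s i} {splitAt s j} eq)) (Fin.join-splitAt s t j))

    pre : ∀ ab → ∃ λ z → z ∈ˡ matched × pair (lookup right (proj₂ ab)) (lookup left (proj₁ ab)) ≡ proj₂ z
    pre (a , b) = ∈-map⁻ proj₂ (proj₂ (adjacent a b))

    host : Fin s × Fin t → Fin m × Subset n
    host = proj₁ ∘ pre

    host-injective : ∀ {ab ab′} → proj₁ (host ab) ≡ proj₁ (host ab′) → ab ≡ ab′
    host-injective {ab@(a , b)} {ab′@(a′ , b′)} eq =
      let _ , z∈  , p≡  = pre ab
          _ , z′∈ , p′≡ = pre ab′
          z≡z′          = map-unique⇒injective fst-unique z∈ z′∈ eq
          y≡y′ , x≡x′   = pair-injective (proj₁ (adjacent a′ b)) (proj₁ (adjacent a b′) ∘ sym)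
                            (trans p≡ (trans (cong proj₂ z≡z′) (sym p′≡)))
      in cong₂ _,_ (lookup-injective uˡ x≡x′) (lookup-injective uʳ y≡y′)

    covers : ∀ ab {x} → x ∈ Kedge s t ab → φ x ∈ E (proj₁ (host ab))
    covers ab@(a , b) {x} x∈ = proj₂ (All.lookup two-subset (proj₁ (proj₂ (pre ab))))
      (subst (φ x ∈_) (proj₂ (proj₂ (pre ab))) (case ∈-pair⁻ (a ↑ˡ t) (s ↑ʳ b) x∈ of λ where
        (inj₁ refl) → subst (λ z → vertex z ∈ p) (sym (Fin.splitAt-↑ˡ s a t)) (b∈pair (lookup right b) (lookup left a))
        (inj₂ refl) → subst (λ z → vertex z ∈ p) (sym (Fin.splitAt-↑ʳ s t b)) (a∈pair (lookup right b) (lookup left a))))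
      where
      p = pair (lookup right b) (lookup left a)

  open CliqueSets _~?_ public

  matched≤cliques : length matched ≤ cliques 2 (allFin n)
  matched≤cliques = begin
    length matched                    ≡⟨ length-map proj₂ matched ⟨
    length (map proj₂ matched)        ≤⟨ injection⇒≤length (lookup-injective snd-unique) (∈-cliques ∘ ∈-lookup) ⟩
    length (cliqueSets 2 (allFin n))  ≡⟨ length-cliqueSets 2 (allFin n) ⟩
    cliques 2 (allFin n)              ∎
    where
    open ≤-Reasoning
    ∈-cliques : ∀ {p} → p ∈ˡ map proj₂ matched → p ∈ˡ cliqueSets 2 (allFin n)
    ∈-cliques {p} p∈ with ∈-map⁻ proj₂ p∈
    ... | z , z∈ , refl = ∈-cliqueSets 2 (allFin n) p ∣p∣ (λ {x} _ → ∈-allFin x)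
      λ x∈ y∈ x≢y → x≢y , subst (_∈ˡ map proj₂ matched) (sym (pair≡ ∣p∣ x∈ y∈ x≢y)) p∈
      where ∣p∣ = proj₁ (All.lookup two-subset z∈)

-- The bound on the number of hyperedges.

-- Every hyperedge appears, as a vertex set, in one list: the matched hyperedges followed by the
-- r-cliques. An unmatched one is a clique because maximality says that all its pairs are assigned.
-- Injectivity of E then bounds m by the length.
size≤cliques : ∀ {n m r} {E : Fin m → Subset n} → Injective _≡_ _≡_ E → (∀ e → ∣ E e ∣ ≡ r) →
               (M : Matching E (allFin m)) → let open MatchedGraph M in
               m ≤ cliques 2 (allFin n) + cliques r (allFin n)
size≤cliques {n} {m} {r} {E} E-injective uniform M = begin
  m                                                              ≤⟨ injection⇒≤length E-injective covered ⟩
  length (map (E ∘ proj₁) matched ++ cliqueSets r (allFin n))      ≡⟨ length-++ (map (E ∘ proj₁) matched) ⟩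
  length (map (E ∘ proj₁) matched) + length (cliqueSets r (allFin n))
    ≡⟨ cong₂ _+_ (length-map (E ∘ proj₁) matched) (length-cliqueSets r (allFin n)) ⟩
  length matched + cliques r (allFin n)                          ≤⟨ +-monoˡ-≤ (cliques r (allFin n)) matched≤cliques ⟩
  cliques 2 (allFin n) + cliques r (allFin n)                    ∎
  where
  open ≤-Reasoning
  open Matching M
  open MatchedGraph M

  covered : ∀ e → E e ∈ˡ map (E ∘ proj₁) matched ++ cliqueSets r (allFin n)
  covered e with maximal (∈-allFin e)
  ... | inj₁ e∈ with ∈-map⁻ proj₁ e∈
  ...   | z , z∈ , refl = ∈-++⁺ˡ (∈-map⁺ (E ∘ proj₁) z∈)
  covered e | inj₂ all = ∈-++⁺ʳ (map (E ∘ proj₁) matched)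
    (∈-cliqueSets r (allFin n) (E e) (uniform e) (λ {x} _ → ∈-allFin x)
      λ {x} {y} x∈ y∈ x≢y → x≢y , all (pair x y) (∣pair∣≡2 x y x≢y) (pair⊆ x∈ y∈))

-- Replacing x + y by twice the maximum avoids expanding a k-th power of a sum.
add-bounds : ∀ k {m x y c d} n .{{_ : NonZero n}} {e e′} → m ≤ x + y → e ≤ e′ →
             x ^ k ≤ c ^ k * n ^ e → y ^ k ≤ d ^ k * n ^ e′ →
             m ^ k ≤ (2 * (c + d)) ^ k * n ^ e′
add-bounds k {m} {x} {y} {c} {d} n {e} {e′} m≤x+y e≤e′ hx hy = begin
  m ^ k                            ≤⟨ ^-monoˡ-≤ k m≤x+y ⟩
  (x + y) ^ k                      ≤⟨ ^-monoˡ-≤ k (+-mono-≤ (m≤m⊔n x y) (≤-trans (m≤n⊔m x y) (≤-reflexive (sym (+-identityʳ _))))) ⟩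
  (2 * (x ⊔ y)) ^ k                ≡⟨ ^-distribʳ-* 2 (x ⊔ y) k ⟩
  2 ^ k * (x ⊔ y) ^ k              ≤⟨ *-monoʳ-≤ (2 ^ k) max-bound ⟩
  2 ^ k * ((c + d) ^ k * n ^ e′)   ≡⟨ *-assoc (2 ^ k) _ _ ⟨
  2 ^ k * (c + d) ^ k * n ^ e′     ≡⟨ cong (_* n ^ e′) (^-distribʳ-* 2 (c + d) k) ⟨
  (2 * (c + d)) ^ k * n ^ e′       ∎
  where
  open ≤-Reasoning
  max-bound : (x ⊔ y) ^ k ≤ (c + d) ^ k * n ^ e′
  max-bound with ⊔-sel x y
  ... | inj₁ eq = subst (λ z → z ^ k ≤ (c + d) ^ k * n ^ e′) (sym eq)
                    (≤-trans hx (*-mono-≤ (^-monoˡ-≤ k (m≤m+n c d)) (^-monoʳ-≤ n e≤e′)))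
  ... | inj₂ eq = subst (λ z → z ^ k ≤ (c + d) ^ k * n ^ e′) (sym eq)
                    (≤-trans hy (*-monoˡ-≤ (n ^ e′) (^-monoˡ-≤ k (m≤n+m d c))))

-- The same s is split in two ways: as 2 + (i + j) to bound the edges of the assigned graph, and as
-- r + j to bound its r-cliques.
attainable-bound : ∀ i j t n .{{_ : NonZero n}} {m} → let r = 2 + i; s = r + j in
  Attainable r n (K s t) m →
  m ^ (2 * s) ≤
  (2 * (clique-constant 1 (i + j) t + clique-constant (suc i) j t)) ^ (2 * s) * n ^ (r * (r + suc (2 * j)))
attainable-bound i j t n (H , refl , uniform , free) =
  add-bounds (2 * s) {x = cliques 2 V} {cliques r V} {clique-constant 1 (i + j) t} {clique-constant (suc i) j t}
    n {2 * (2 + suc (2 * (i + j)))} {r * (r + suc (2 * j))}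
    (size≤cliques (edge-injective H) uniform M)
    -- The exponent for edges is smaller than the one for r-cliques by i + i * i + 2 * (i * j), so
    -- the clique term dominates.
    (m+n≤o⇒m≤o _ (≤-reflexive (eq i j)))
    (bound 1 (i + j) no-biclique)
    (bound (suc i) j no-biclique)
  where
  r = 2 + i
  s = r + j
  V = allFin n
  M = greedy (edge H) (allFin _) (Unique.allFin⁺ _)
  open MatchedGraph M

  no-biclique : ¬ Biclique _~_ s t V V
  no-biclique = free ∘ copy⇒berge (K s t) H ∘ biclique⇒copy

  eq : ∀ i j → 2 * (2 + suc (2 * (i + j))) + (i + i * i + 2 * (i * j)) ≡ (2 + i) * (2 + i + suc (2 * j))
  eq = solve-∀

  bound : ∀ k j → ¬ Biclique _~_ (suc k + j) t V V →
          cliques (suc k) V ^ (2 * (suc k + j)) ≤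
          clique-constant k j t ^ (2 * (suc k + j)) * n ^ (suc k * (suc k + suc (2 * j)))
  bound k j free′ =
    subst (λ z → cliques (suc k) V ^ (2 * (suc k + j)) ≤
                 clique-constant k j t ^ (2 * (suc k + j)) * z ^ (suc k * (suc k + suc (2 * j))))
          (length-tabulate {n = n} (λ v → v))
          (cliques-bound ~-sym ~-irrefl k j t (Unique.allFin⁺ n) free′)

theorem1p6 : (r s t : ℕ) → 3 ≤ r → r ≤ s → s ≤ t → (λ n → ex r n (K s t)) =O[n^ r * (2 * s) ∸ r * (r ∸ 1) / 2 * s ]
theorem1p6 r@(suc (suc i)) s t (s≤s (s≤s _)) r≤s s≤t = C , 1 , λ n 1≤n →
  -- The threshold 1 makes n positive, hence n ^ e monotone in e. The bound is obtained with r + (s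
  -- ∸ r) in place of s and then rewritten.
  subst₂ (λ s e → ex r n (K s t) ^ (2 * s) ≤ C ^ (2 * s) * n ^ e) (m+[n∸m]≡n r≤s) (exponent s r≤s)
    (attainable-bound i (s ∸ r) t n {{>-nonZero 1≤n}} (ex-attained r n (K (r + (s ∸ r)) t) has-edge))
  where
  C = 2 * (clique-constant 1 (i + (s ∸ r)) t + clique-constant (suc i) (s ∸ r) t)

  -- An edge in K_{s,t} guarantees that the maximum is attained, so the bound on attainable sizes
  -- applies to `ex`.
  has-edge : 0 < (r + (s ∸ r)) * t
  has-edge = ≤-trans (≤-trans (≤-trans (s≤s z≤n) r≤s) s≤t) (m≤m+n t _)

  eq : ∀ i j → (2 + i) * (2 * (2 + i + j)) ≡ (2 + i) * suc i + (2 + i) * (2 + i + suc (2 * j))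
  eq = solve-∀

  -- For s ≥ r, 2rs = r(r - 1) + r(2s - r + 1), so the truncated subtraction is exact.
  exponent : ∀ s → r ≤ s → r * (r + suc (2 * (s ∸ r))) ≡ r * (2 * s) ∸ r * suc i
  exponent s r≤s = sym (begin
    r * (2 * s) ∸ r * suc i               ≡⟨ cong (λ s → r * (2 * s) ∸ r * suc i) (m+[n∸m]≡n r≤s) ⟨
    r * (2 * (r + (s ∸ r))) ∸ r * suc i   ≡⟨ cong (_∸ r * suc i) (eq i (s ∸ r)) ⟩
    r * suc i + r * (r + suc (2 * (s ∸ r))) ∸ r * suc i ≡⟨ m+n∸m≡n (r * suc i) _ ⟩
    r * (r + suc (2 * (s ∸ r)))           ∎)
    where open ≡-Reasoning
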